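{- Consider deterministic automata $G$ over finite event sets $E$ with uncontrollable events $E_{uc}\subseteq E$, metrics $d$ on $E$ with values in $[0,1]$, and $\lambda\in[0,1]$. (1) For all such $G,E_{uc},d,\lambda$: if $K_1,K_2\subseteq L(G)$ are $\lambda$-controllable, then so is $K_1\cup K_2$. (2) If $K_1,K_2$ are $\lambda$-controllable, then $K_1\cap K_2$ need not be $\lambda$-controllable; that is, there exist $G,E_{uc},d,\lambda$ and $\lambda$-controllable languages $K_1,K_2\subseteq L(G)$ such that $K_1\cap K_2$ is not $\lambda$-controllable. (3) For all such $G,E_{uc},d,\lambda$ and $K\subseteq L(G)$: if $\widetilde K_1$ and $\widetilde K_2$ are two realizations of $K$, then so is $\widetilde K_1\cup\widetilde K_2$. But $\widetilde K_1\cap\widetilde K_2$ is not necessarily a realization of $K$; that is, there exist $G,E_{uc},d,\lambda,K$ and realizations $\widetilde K_1,\widetilde K_2$ of $K$ such that $\widetilde K_1\cap\widetilde K_2$ is not a realization of $K$.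
   Context: Setting. $E$ is a finite set of events, partitioned as $E=E_c\sqcup E_{uc}$ (controllable / uncontrollable events); $E^*$ is the set of finite strings over $E$ including the empty string $\epsilon$; $l(s)$ is the length of a string $s$; $\overline{L}$ is the prefix closure of a language $L\subseteq E^*$. $G=(Q,E,\delta,q_0)$ is a deterministic automaton with partial transition function $\delta:Q\times E\to Q$, extended to strings as usual, and $L(G)=\{s\in E^*:\delta(q_0,s)\text{ is defined}\}$ (a prefix closed language containing $\epsilon$). Metrics. $d$ is a metric on $E$ with values in $[0,1]$. Set $d(\epsilon,\epsilon)=0$ and $d(a,\epsilon)=d(\epsilon,a)=1$ for $a\in E$. For strings $s=s_1\cdots s_{l(s)}$, $t=t_1\cdots t_{l(t)}$, pad the shorter one with $\epsilon$'s and define $d(s,t)=\sum_{i=1}^{\max\{l(s),l(t)\}}2^{ -i}d(s_i,t_i)$. For a string $s$ and a language $A$, $d(s,A)=\inf_{a\in A}d(s,a)$ if $A\neq\emptyset$ and $d(s,\emptyset)=1$. For languages $A,B$, $d(A,B)$ is the Hausdorff metric: $d(\emptyset,\emptyset)=0$, and otherwise $d(A,B)=\max\{\sup_{a\in A}d(a,B),\sup_{b\in B}d(b,A)\}$ (a supremum over the empty set being $0$). Controllability. A language $K\subseteq L(G)$ is controllable if $\overline{K}E_{uc}\cap L(G)\subseteq\overline{K}$. A language $K\subseteq L(G)$ is $\lambda$-controllable if there is a controllable language $\widetilde K\subseteq L(G)$ with $d(\widetilde K,K)\le\lambda$; such a $\widetilde K$ is called a realization of $K$. -}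

module Defs where

open import Data.Empty using (⊥-elim)
open import Data.Fin.Base using (Fin)
open import Data.Fin.Subset using (Subset) renaming (_∈_ to _∈ˢ_)
open import Data.List.Base using (List; []; _∷_; _++_; _∷ʳ_; length; head; drop)
open import Data.Maybe using (Maybe; just; nothing; maybe′; Is-just; _>>=_)
open import Data.Nat.Base as ℕ using (ℕ; zero; suc)
import Data.Nat.Properties as ℕ
open import Data.Product.Base using (∃; ∃₂; _×_; _,_; proj₁; proj₂)
open import Data.Rational.Base as ℚ using (ℚ; 0ℚ; 1ℚ; ½)
import Data.Rational.Properties as ℚ
open import Data.Sum.Base using (inj₁; inj₂)
open import Level using (0ℓ)
open import Relation.Binary.PropositionalEquality
  using (_≡_; refl; sym; trans; cong; subst; subst₂)
open import Relation.Nullary.Decidable.Core using (from-yes)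
open import Relation.Unary using (Pred; _∈_; _⊆_; _∩_; Empty; Satisfiable)

-- Real numbers, as one-sided Dedekind cuts of ℚ.  `q ∈ cut x` is read
-- x < q.  Classically these are exactly the reals; constructively they
-- are the upper reals, which have all infima of inhabited families
-- bounded below and all suprema of inhabited families bounded above.
record ℝ : Set₁ where
  field
    cut       : Pred ℚ 0ℓ
    upward    : ∀ {p q} → p ℚ.≤ q → p ∈ cut → q ∈ cut
    rounded   : ∀ {q} → q ∈ cut → ∃ λ p → p ℚ.< q × p ∈ cut
    inhabited : Satisfiable cut
    bounded   : ∃ λ l → ∀ {q} → q ∈ cut → l ℚ.< q

open ℝ public

infix 4 _≤_ _≈_

_≤_ : ℝ → ℝ → Set
x ≤ y = cut y ⊆ cut x

_≈_ : ℝ → ℝ → Set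
x ≈ y = x ≤ y × y ≤ x

private
  p<p+1 : ∀ p → p ℚ.< p ℚ.+ 1ℚ
  p<p+1 p = subst (ℚ._< p ℚ.+ 1ℚ) (ℚ.+-identityʳ p)
    (ℚ.+-monoʳ-< p (from-yes (0ℚ ℚ.<? 1ℚ)))

  ½+½ : ∀ q → q ℚ.* ½ ℚ.+ q ℚ.* ½ ≡ q
  ½+½ q = trans (sym (ℚ.*-distribˡ-+ q ½ ½)) (ℚ.*-identityʳ q)

  ½[q+q] : ∀ q → (q ℚ.+ q) ℚ.* ½ ≡ q
  ½[q+q] q = trans (ℚ.*-distribʳ-+ ½ q q) (½+½ q)

  ½-mono-< : ∀ {p q} → p ℚ.< q → p ℚ.* ½ ℚ.< q ℚ.* ½
  ½-mono-< = ℚ.*-monoˡ-<-pos ½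

fromℚ : ℚ → ℝ
fromℚ p = record
  { cut       = p ℚ.<_
  ; upward    = λ q≤r p<q → ℚ.<-≤-trans p<q q≤r
  ; rounded   = λ p<q → let m , p<m , m<q = ℚ.<-dense p<q in m , m<q , p<m
  ; inhabited = p ℚ.+ 1ℚ , p<p+1 p
  ; bounded   = p , λ p<q → p<q
  }

0ℝ 1ℝ : ℝ
0ℝ = fromℚ 0ℚ
1ℝ = fromℚ 1ℚ

infixl 6 _+_ _⊔_

_+_ : ℝ → ℝ → ℝ
x + y = record
  { cut       = λ q → ∃₂ λ r s → r ∈ cut x × s ∈ cut y × r ℚ.+ s ℚ.≤ q
  ; upward    = λ p≤q (r , s , xr , ys , r+s≤p) →
                  r , s , xr , ys , ℚ.≤-trans r+s≤p p≤q
  ; rounded   = λ (r , s , xr , ys , r+s≤q) →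
                  let r′ , r′<r , xr′ = rounded x xr in
                  r′ ℚ.+ s , ℚ.<-≤-trans (ℚ.+-monoˡ-< s r′<r) r+s≤q ,
                  r′ , s , xr′ , ys , ℚ.≤-refl
  ; inhabited = let r , xr = inhabited x ; s , ys = inhabited y in
                r ℚ.+ s , r , s , xr , ys , ℚ.≤-refl
  ; bounded   = let l , l<x = bounded x ; m , m<y = bounded y in
                l ℚ.+ m , λ (r , s , xr , ys , r+s≤q) →
                  ℚ.<-≤-trans (ℚ.+-mono-< (l<x xr) (m<y ys)) r+s≤q
  }

half : ℝ → ℝ
half x = record
  { cut       = λ q → q ℚ.+ q ∈ cut x
  ; upward    = λ p≤q → upward x (ℚ.+-mono-≤ p≤q p≤q)
  ; rounded   = λ {q} x2q → let r , r<2q , xr = rounded x x2q in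
                  r ℚ.* ½ ,
                  subst (r ℚ.* ½ ℚ.<_) (½[q+q] q) (½-mono-< r<2q) ,
                  subst (cut x) (sym (½+½ r)) xr
  ; inhabited = let r , xr = inhabited x in
                r ℚ.* ½ , subst (cut x) (sym (½+½ r)) xr
  ; bounded   = let l , l<x = bounded x in
                l ℚ.* ½ , λ {q} x2q →
                  subst (l ℚ.* ½ ℚ.<_) (½[q+q] q) (½-mono-< (l<x x2q))
  }

_⊔_ : ℝ → ℝ → ℝ
x ⊔ y = record
  { cut       = cut x ∩ cut y
  ; upward    = λ p≤q (xp , yp) → upward x p≤q xp , upward y p≤q yp
  ; rounded   = λ (xq , yq) → common (rounded x xq) (rounded y yq)
  ; inhabited = let r , xr = inhabited x ; s , ys = inhabited y in
                r ℚ.⊔ s , upward x (ℚ.p≤p⊔q r s) xr , upward y (ℚ.p≤q⊔p r s) ys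
  ; bounded   = let l , l<x = bounded x in l , λ (xq , _) → l<x xq
  }
  where
  common : ∀ {q} → (∃ λ p → p ℚ.< q × p ∈ cut x) →
           (∃ λ p → p ℚ.< q × p ∈ cut y) →
           ∃ λ p → p ℚ.< q × p ∈ (cut x ∩ cut y)
  common (r , r<q , xr) (s , s<q , ys) with ℚ.≤-total r s
  ... | inj₁ r≤s = s , s<q , upward x r≤s xr , ys
  ... | inj₂ s≤r = r , r<q , xr , upward y s≤r ys

inf : {I : Set} (f : I → ℝ) → I → (∃ λ l → ∀ i → fromℚ l ≤ f i) → ℝ
inf f i₀ (l , l≤f) = record
  { cut       = λ q → ∃ λ i → q ∈ cut (f i)
  ; upward    = λ p≤q (i , fp) → i , upward (f i) p≤q fp
  ; rounded   = λ (i , fq) → let p , p<q , fp = rounded (f i) fq in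
                  p , p<q , i , fp
  ; inhabited = let q , fq = inhabited (f i₀) in q , i₀ , fq
  ; bounded   = l , λ (i , fq) → l≤f i fq
  }

-- The strict gap p < q makes the intersection of the cuts rounded.
sup : {I : Set} (f : I → ℝ) → I → (∃ λ u → ∀ i → f i ≤ fromℚ u) → ℝ
sup f i₀ (u , f≤u) = record
  { cut       = λ q → ∃ λ p → p ℚ.< q × (∀ i → p ∈ cut (f i))
  ; upward    = λ q≤r (p , p<q , fp) → p , ℚ.<-≤-trans p<q q≤r , fp
  ; rounded   = λ (p , p<q , fp) → let m , p<m , m<q = ℚ.<-dense p<q in
                  m , m<q , p , p<m , fp
  ; inhabited = (u ℚ.+ 1ℚ) ℚ.+ 1ℚ , u ℚ.+ 1ℚ , p<p+1 _ ,
                λ i → f≤u i (p<p+1 u)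
  ; bounded   = let l , l<f = bounded (f i₀) in
                l , λ (p , p<q , fp) → ℚ.<-trans (l<f (fp i₀)) p<q
  }

InUnitInterval : ℝ → Set
InUnitInterval x = 0ℝ ≤ x × x ≤ 1ℝ

sum< : ℕ → (ℕ → ℝ) → ℝ
sum< zero    f = 0ℝ
sum< (suc n) f = f 0 + sum< n (λ i → f (suc i))

syntax sum< n (λ i → x) = Σ[ i < n ] x

2^-[_]*_ : ℕ → ℝ → ℝ
2^-[ zero  ]* x = x
2^-[ suc k ]* x = half (2^-[ k ]* x)

String : ℕ → Set
String n = List (Fin n)

Language : ℕ → Set₁
Language n = Pred (String n) 0ℓ

prefixClosure : ∀ {n} → Language n → Language n
prefixClosure K s = ∃ λ t → s ++ t ∈ K

infixl 7 _·_

_·_ : ∀ {n} → Language n → Subset n → Language n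
(K · A) w = ∃₂ λ s a → s ∈ K × a ∈ˢ A × w ≡ s ∷ʳ a

record Automaton (n : ℕ) : Set₁ where
  field
    Q  : Set
    δ  : Q → Fin n → Maybe Q
    q₀ : Q

  δ* : Q → String n → Maybe Q
  δ* q []      = just q
  δ* q (a ∷ s) = δ q a >>= λ q′ → δ* q′ s

L : ∀ {n} → Automaton n → Language n
L G s = Is-just (δ* q₀ s) where open Automaton G

record Metric (n : ℕ) : Set₁ where
  field
    dist      : Fin n → Fin n → ℝ
    unit      : ∀ a b → InUnitInterval (dist a b)
    zero⇒≡    : ∀ {a b} → dist a b ≈ 0ℝ → a ≡ b
    reflexive : ∀ a → dist a a ≈ 0ℝ
    symmetric : ∀ a b → dist a b ≈ dist b a
    triangle  : ∀ a b c → dist a c ≤ dist a b + dist b c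

module _ {n : ℕ} (d : Metric n) where
  open Metric d

  -- `nothing` is the padding symbol ε.
  distε : Maybe (Fin n) → Maybe (Fin n) → ℝ
  distε nothing  nothing  = 0ℝ
  distε (just _) nothing  = 1ℝ
  distε nothing  (just _) = 1ℝ
  distε (just a) (just b) = dist a b

  -- Positions are counted from 0, so position i has weight 2⁻⁽ⁱ⁺¹⁾.
  distString : String n → String n → ℝ
  distString s t = Σ[ i < length s ℕ.⊔ length t ]
    (2^-[ suc i ]* distε (head (drop i s)) (head (drop i t)))

private
  0ℝ≤ : ∀ {x y} → 0ℝ ≤ x → 0ℝ ≤ y → 0ℝ ≤ x + y
  0ℝ≤ 0≤x 0≤y (r , s , xr , ys , r+s≤q) =
    ℚ.<-≤-trans (ℚ.+-mono-< (0≤x xr) (0≤y ys)) r+s≤q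

  half-nonneg : ∀ {x} → 0ℝ ≤ x → 0ℝ ≤ half x
  half-nonneg 0≤x {q} x2q =
    subst (0ℚ ℚ.<_) (½[q+q] q) (½-mono-< (0≤x x2q))

  scale-nonneg : ∀ k {x} → 0ℝ ≤ x → 0ℝ ≤ 2^-[ k ]* x
  scale-nonneg zero        0≤x = 0≤x
  scale-nonneg (suc k) {x} 0≤x =
    half-nonneg {2^-[ k ]* x} (scale-nonneg k {x} 0≤x)

  scale-mono : ∀ k {x y} → x ≤ y → 2^-[ k ]* x ≤ 2^-[ k ]* y
  scale-mono zero            x≤y    = x≤y
  scale-mono (suc k) {x} {y} x≤y yq = scale-mono k {x} {y} x≤y yq

  sum-nonneg : ∀ m f → (∀ i → 0ℝ ≤ f i) → 0ℝ ≤ sum< m f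
  sum-nonneg zero    f 0≤f = λ 0<q → 0<q
  sum-nonneg (suc m) f 0≤f = 0ℝ≤ {f 0} {sum< m (λ i → f (suc i))} (0≤f 0)
    (sum-nonneg m (λ i → f (suc i)) (λ i → 0≤f (suc i)))

  half+half : ∀ z → half z + half z ≤ z
  half+half z {q} zq = q ℚ.* ½ , q ℚ.* ½ , z½ , z½ , ℚ.≤-reflexive (½+½ q)
    where z½ = subst (cut z) (sym (½+½ q)) zq

  0≤1 : 0ℝ ≤ 1ℝ
  0≤1 = ℚ.<-trans (from-yes (0ℚ ℚ.<? 1ℚ))

  geometric : ∀ m k f → (∀ i → f i ≤ 2^-[ suc i ℕ.+ k ]* 1ℝ) →
              sum< m f ≤ 2^-[ k ]* 1ℝ
  geometric zero    k f f≤ = scale-nonneg k {1ℝ} 0≤1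
  geometric (suc m) k f f≤ q∈ =
    let r , s , r∈ , s∈ , r+s≤q = half+half (2^-[ k ]* 1ℝ) q∈ in
    r , s , f≤ 0 r∈ , geometric m (suc k) (λ i → f (suc i)) f≤′ s∈ , r+s≤q
    where
    f≤′ : ∀ i → f (suc i) ≤ 2^-[ suc i ℕ.+ suc k ]* 1ℝ
    f≤′ i = subst (λ j → f (suc i) ≤ 2^-[ j ]* 1ℝ)
              (sym (cong suc (ℕ.+-suc i k))) (f≤ (suc i))

module _ {n : ℕ} (d : Metric n) where
  open Metric d

  distε-unit : ∀ a b → InUnitInterval (distε d a b)
  distε-unit nothing  nothing  = (λ 0<q → 0<q) , 0≤1
  distε-unit (just _) nothing  = 0≤1 , λ 1<q → 1<q
  distε-unit nothing  (just _) = 0≤1 , λ 1<q → 1<q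
  distε-unit (just a) (just b) = unit a b

  distString-unit : ∀ s t → InUnitInterval (distString d s t)
  distString-unit s t =
    sum-nonneg m f (λ i → scale-nonneg (suc i) {e i} (proj₁ (e-unit i))) ,
    λ {q} → geometric m 0 f f≤ {q}
    where
    m = length s ℕ.⊔ length t
    e f : ℕ → ℝ
    e i = distε d (head (drop i s)) (head (drop i t))
    f i = 2^-[ suc i ]* e i
    e-unit : ∀ i → InUnitInterval (e i)
    e-unit i = distε-unit (head (drop i s)) (head (drop i t))
    f≤ : ∀ i → f i ≤ 2^-[ suc i ℕ.+ 0 ]* 1ℝ
    f≤ i {q} = subst (λ j → q ∈ cut (2^-[ j ]* 1ℝ) → q ∈ cut (f i))
      (sym (ℕ.+-identityʳ (suc i)))
      (scale-mono (suc i) {e i} {1ℝ} (proj₂ (e-unit i)) {q})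

  private
    pointFamily : (s : String n) (A : Language n) → Maybe (∃ A) → ℝ
    pointFamily s A = maybe′ (λ (a , _) → distString d s a) 1ℝ

    pointFamily≥0 : ∀ s A i → 0ℝ ≤ pointFamily s A i
    pointFamily≥0 s A (just (a , _)) = proj₁ (distString-unit s a)
    pointFamily≥0 s A nothing        = 0≤1

  -- The infimum of { d(s,a) ∣ a ∈ A } ∪ {1}.  As d(s,a) ≤ 1, including 1
  -- only matters for A = ∅, and it avoids deciding whether A is empty;
  -- see distPoint-∅, distPoint-lower and distPoint-greatest.
  distPoint : String n → Language n → ℝ
  distPoint s A = inf (pointFamily s A) nothing (0ℚ , pointFamily≥0 s A)

  private
    excessFamily : (A B : Language n) → Maybe (∃ A) → ℝ
    excessFamily A B = maybe′ (λ (a , _) → distPoint a B) 0ℝ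

    excessFamily≤1 : ∀ A B i → excessFamily A B i ≤ 1ℝ
    excessFamily≤1 A B (just (a , _)) = λ 1<q → nothing , 1<q
    excessFamily≤1 A B nothing        = 0≤1

  -- The supremum of { d(a,B) ∣ a ∈ A } ∪ {0}; including 0 only matters
  -- for A = ∅.
  excess : Language n → Language n → ℝ
  excess A B = sup (excessFamily A B) nothing (1ℚ , excessFamily≤1 A B)

  -- For A = B = ∅ this is 0; see hausdorff-∅.
  hausdorff : Language n → Language n → ℝ
  hausdorff A B = excess A B ⊔ excess B A

  distPoint-∅ : ∀ s A → Empty A → distPoint s A ≈ 1ℝ
  distPoint-∅ s A A=∅ = (λ 1<q → nothing , 1<q) , λ where
    (just (a , a∈A) , _) → ⊥-elim (A=∅ a a∈A)
    (nothing , 1<q)      → 1<q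

  distPoint-lower : ∀ s A {a} → a ∈ A → distPoint s A ≤ distString d s a
  distPoint-lower s A {a} a∈A q∈ = just (a , a∈A) , q∈

  distPoint-greatest : ∀ s A → Satisfiable A → ∀ x →
    (∀ {a} → a ∈ A → x ≤ distString d s a) → x ≤ distPoint s A
  distPoint-greatest s A (a₀ , a₀∈A) x x≤ (just (a , a∈A) , q∈) = x≤ a∈A q∈
  distPoint-greatest s A (a₀ , a₀∈A) x x≤ (nothing , 1<q) =
    x≤ a₀∈A (proj₂ (distString-unit s a₀) 1<q)

  excess-∅ : ∀ A B → Empty A → excess A B ≈ 0ℝ
  excess-∅ A B A=∅ = ≤0 , λ (p , p<q , p∈) → ℚ.<-trans (p∈ nothing) p<q
    where
    ≤0 : excess A B ≤ 0ℝ
    ≤0 0<q = let m , 0<m , m<q = ℚ.<-dense 0<q in m , m<q , λ where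
      (just (a , a∈A)) → ⊥-elim (A=∅ a a∈A)
      nothing          → 0<m

  excess-upper : ∀ A B {a} → a ∈ A → distPoint a B ≤ excess A B
  excess-upper A B {a} a∈A (p , p<q , p∈) =
    upward (distPoint a B) (ℚ.<⇒≤ p<q) (p∈ (just (a , a∈A)))

  excess-least : ∀ A B → Satisfiable A → ∀ x →
    (∀ {a} → a ∈ A → distPoint a B ≤ x) → excess A B ≤ x
  excess-least A B (a₀ , a₀∈A) x ≤x q∈ =
    let p , p<q , p∈ = rounded x q∈ in p , p<q , λ where
      (just (a , a∈A)) → ≤x a∈A p∈
      nothing          → let i , p∈i = ≤x a₀∈A p∈ in pointFamily≥0 a₀ B i p∈i

  hausdorff-∅ : ∀ A B → Empty A → Empty B → hausdorff A B ≈ 0ℝ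
  hausdorff-∅ A B A=∅ B=∅ =
    (λ 0<q → proj₁ (excess-∅ A B A=∅) 0<q , proj₁ (excess-∅ B A B=∅) 0<q) ,
    λ (q∈ , _) → proj₂ (excess-∅ A B A=∅) q∈

module _ {n : ℕ} (G : Automaton n) (Euc : Subset n) where

  Controllable : Language n → Set
  Controllable K =
    K ⊆ L G × (prefixClosure K · Euc) ∩ L G ⊆ prefixClosure K

  module _ (d : Metric n) (λ₀ : ℝ) where

    IsRealization : Language n → Language n → Set
    IsRealization K̃ K = Controllable K̃ × hausdorff d K̃ K ≤ λ₀

    λ-Controllable : Language n → Set₁
    λ-Controllable K = K ⊆ L G × ∃ λ K̃ → IsRealization K̃ K

{-# OPTIONS --safe #-}
-- Unions preserve both controllability and bounds on the Hausdorff distance.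
-- For the counterexamples, let G generate all strings over a single
-- uncontrollable letter u.  The strings of even length, and those of odd
-- length together with ε, both have every string as a prefix, so they are
-- controllable; they meet in {ε}, which is not.  With λ = 1 distances do not
-- matter, so both realize any language, unlike their intersection.  With λ = 0
-- a realization of {ε} would contain some string ut, at distance at least ½
-- from ε, so {ε} is not λ-controllable.
module Submission where

open import Defs
open import Data.Fin.Base using (Fin; zero)
open import Data.Fin.Subset using (Subset; ⊤)
open import Data.Fin.Subset.Properties using (∈⊤)
open import Data.List.Base using ([]; _∷_; _++_; length; head; drop)
open import Data.List.Properties using (length-++)
open import Data.Maybe.Base using (just; nothing)
import Data.Maybe.Relation.Unary.Any as Any
open import Data.Nat.Base using (ℕ; zero; suc)
import Data.Nat.Base as ℕ
open import Data.Nat.Divisibility using (_∣_; _∣0; divides; ∣m+n∣m⇒∣n; ∣1⇒≡1)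
open import Data.Nat.Properties using (+-comm)
open import Data.Nat.Tactic.RingSolver using (solve-∀)
open import Data.Product.Base using (Σ-syntax; _×_; _,_; proj₁; proj₂; ∃)
open import Data.Rational.Base as ℚ using (0ℚ; 1ℚ; ½)
import Data.Rational.Properties as ℚ
open import Data.Sum.Base using (inj₁; inj₂)
import Data.Unit.Base as Unit
open import Function.Base using (id; _∘_)
open import Relation.Binary.PropositionalEquality using (_≡_; refl; sym; trans; subst)
open import Relation.Nullary.Decidable.Core using (from-yes; from-no)
open import Relation.Nullary.Negation.Core using (¬_; contradiction)
open import Relation.Unary using (_∈_; _⊆_; _∪_; _∩_; Universal)

-- Sign bounds for weighted sums of upper reals

0≤1ℝ : 0ℝ ≤ 1ℝ
0≤1ℝ = ℚ.<-trans (from-yes (0ℚ ℚ.<? 1ℚ))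

0∈[0,1] : InUnitInterval 0ℝ
0∈[0,1] = id , 0≤1ℝ

1∈[0,1] : InUnitInterval 1ℝ
1∈[0,1] = 0≤1ℝ , id

0<½ : 0ℚ ℚ.< ½
0<½ = from-yes (0ℚ ℚ.<? ½)

p+p<q+q⇒p<q : ∀ {p q} → p ℚ.+ p ℚ.< q ℚ.+ q → p ℚ.< q
p+p<q+q⇒p<q 2p<2q = ℚ.≰⇒> λ q≤p →
  ℚ.<-irrefl refl (ℚ.<-≤-trans 2p<2q (ℚ.+-mono-≤ q≤p q≤p))

p½+p½ : ∀ p → p ℚ.* ½ ℚ.+ p ℚ.* ½ ≡ p
p½+p½ p = trans (sym (ℚ.*-distribˡ-+ p ½ ½)) (ℚ.*-identityʳ p)

-- The cut of `half x` at `q` is the cut of `x` at `q + q`, so each halving amounts to cancelling a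
-- doubling of `q`.
scale-nonneg : ∀ k {x} → 0ℝ ≤ x → 0ℝ ≤ 2^-[ k ]* x
scale-nonneg zero        0≤x    = 0≤x
scale-nonneg (suc k) {x} 0≤x q∈ = p+p<q+q⇒p<q {0ℚ} (scale-nonneg k {x} 0≤x q∈)

scale-nonpos : ∀ k {x} → x ≤ 0ℝ → 2^-[ k ]* x ≤ 0ℝ
scale-nonpos zero        x≤0     = x≤0
scale-nonpos (suc k) {x} x≤0 0<q = scale-nonpos k {x} x≤0 (ℚ.+-mono-< 0<q 0<q)

sum-nonneg : ∀ m f → (∀ i → 0ℝ ≤ f i) → 0ℝ ≤ sum< m f
sum-nonneg zero    f 0≤f = id
sum-nonneg (suc m) f 0≤f (r , s , r∈ , s∈ , r+s≤q) =
  ℚ.<-≤-trans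
    (ℚ.+-mono-< (0≤f 0 r∈) (sum-nonneg m (f ∘ suc) (λ i → 0≤f (suc i)) s∈)) r+s≤q

sum-nonpos : ∀ m f → (∀ i → f i ≤ 0ℝ) → sum< m f ≤ 0ℝ
sum-nonpos zero    f f≤0 = id
sum-nonpos (suc m) f f≤0 {q} 0<q =
  -- The cut of a sum asks for two rationals adding up to at most `q`; half of `q` goes to the head
  -- and half to the tail.
  q ℚ.* ½ , q ℚ.* ½ , f≤0 0 0<q½ ,
  sum-nonpos m (f ∘ suc) (λ i → f≤0 (suc i)) 0<q½ , ℚ.≤-reflexive (p½+p½ q)
  where
  0<q½ : 0ℚ ℚ.< q ℚ.* ½
  0<q½ = p+p<q+q⇒p<q {0ℚ} (subst (0ℚ ℚ.<_) (sym (p½+p½ q)) 0<q)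

-- Bounds on string and Hausdorff distances

module _ {n : ℕ} (d : Metric n) where
  open Metric d

  distε-refl : ∀ a → distε d a a ≤ 0ℝ
  distε-refl nothing  = id
  distε-refl (just a) = proj₁ (reflexive a)

  distString-refl : ∀ s → distString d s s ≤ 0ℝ
  distString-refl s = sum-nonpos (length s ℕ.⊔ length s) _ λ i →
    scale-nonpos (suc i) {e i} (distε-refl (head (drop i s)))
    where
    e : ℕ → ℝ
    e i = distε d (head (drop i s)) (head (drop i s))

  -- The first position compares `a` with padding and contributes half of 1; the later terms are
  -- nonnegative.
  ½≤distString-[] : ∀ a s → fromℚ ½ ≤ distString d (a ∷ s) []
  ½≤distString-[] a s (r , t , 1<r+r , t∈ , r+t≤q) =
    ℚ.<-≤-trans (ℚ.+-mono-< (p+p<q+q⇒p<q {½} {r} 1<r+r) 0<t) r+t≤q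
    where
    e : ℕ → ℝ
    e i = distε d (head (drop i (a ∷ s))) (head (drop i []))
    0<t : 0ℚ ℚ.< t
    0<t = sum-nonneg (length s) _ (λ i → scale-nonneg (suc (suc i)) {e (suc i)}
      (proj₁ (distε-unit d (head (drop i s)) nothing))) t∈

  distPoint-antitone : ∀ s {A B} → A ⊆ B → distPoint d s B ≤ distPoint d s A
  distPoint-antitone s A⊆B (just (a , a∈A) , q∈) = just (a , A⊆B a∈A) , q∈
  distPoint-antitone s A⊆B (nothing , 1<q)       = nothing , 1<q

  -- The hypothesis `0ℝ ≤ x` handles the default value 0 in the supremum, so `A` may be empty.
  excess-bound : ∀ A B {x} → 0ℝ ≤ x →
    (∀ {a} → a ∈ A → distPoint d a B ≤ x) → excess d A B ≤ x
  excess-bound A B {x} 0≤x ≤x q∈ =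
    -- The cut of a supremum needs one `p` strictly below `q` that works for all indices;
    -- roundedness of `x` supplies it.
    let p , p<q , p∈ = rounded x q∈ in p , p<q , λ where
      (just (a , a∈A)) → ≤x a∈A p∈
      nothing          → 0≤x p∈

  -- A point of `A₁` or `A₂` is close to its own partner, and enlarging the target only lowers the
  -- distance.
  excess-∪ : ∀ A₁ A₂ B₁ B₂ {x} → 0ℝ ≤ x →
    excess d A₁ B₁ ≤ x → excess d A₂ B₂ ≤ x → excess d (A₁ ∪ A₂) (B₁ ∪ B₂) ≤ x
  excess-∪ A₁ A₂ B₁ B₂ {x} 0≤x ≤x₁ ≤x₂ = excess-bound (A₁ ∪ A₂) (B₁ ∪ B₂) {x} 0≤x bound
    where
    bound : ∀ {a} → a ∈ A₁ ∪ A₂ → distPoint d a (B₁ ∪ B₂) ≤ x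
    bound {a} (inj₁ a∈A₁) q∈ =
      distPoint-antitone a inj₁ (excess-upper d A₁ B₁ a∈A₁ (≤x₁ q∈))
    bound {a} (inj₂ a∈A₂) q∈ =
      distPoint-antitone a inj₂ (excess-upper d A₂ B₂ a∈A₂ (≤x₂ q∈))

  hausdorff-∪ : ∀ A₁ A₂ B₁ B₂ {x} → 0ℝ ≤ x →
    hausdorff d A₁ B₁ ≤ x → hausdorff d A₂ B₂ ≤ x →
    hausdorff d (A₁ ∪ A₂) (B₁ ∪ B₂) ≤ x
  hausdorff-∪ A₁ A₂ B₁ B₂ {x} 0≤x ≤x₁ ≤x₂ q∈ =
    excess-∪ A₁ A₂ B₁ B₂ {x} 0≤x (proj₁ ∘ ≤x₁) (proj₁ ∘ ≤x₂) q∈ ,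
    excess-∪ B₁ B₂ A₁ A₂ {x} 0≤x (proj₂ ∘ ≤x₁) (proj₂ ∘ ≤x₂) q∈

  hausdorff-∪ˡ : ∀ A₁ A₂ B {x} → 0ℝ ≤ x →
    hausdorff d A₁ B ≤ x → hausdorff d A₂ B ≤ x → hausdorff d (A₁ ∪ A₂) B ≤ x
  hausdorff-∪ˡ A₁ A₂ B {x} 0≤x ≤x₁ ≤x₂ q∈ =
    excess-bound (A₁ ∪ A₂) B {x} 0≤x (λ where
      (inj₁ a∈A₁) r∈ → excess-upper d A₁ B a∈A₁ (proj₁ (≤x₁ r∈))
      (inj₂ a∈A₂) r∈ → excess-upper d A₂ B a∈A₂ (proj₁ (≤x₂ r∈))) q∈ ,
    -- In this direction one bound suffices: `b` is already close to `A₁`.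
    excess-bound B (A₁ ∪ A₂) {x} 0≤x (λ {b} b∈B r∈ →
      distPoint-antitone b inj₁ (excess-upper d B A₁ b∈B (proj₂ (≤x₁ r∈)))) q∈

  excess-refl : ∀ A → excess d A A ≤ 0ℝ
  excess-refl A = excess-bound A A {0ℝ} id λ {a} a∈A 0<q →
    distPoint-lower d a A a∈A (distString-refl a 0<q)

  hausdorff-refl : ∀ A → hausdorff d A A ≤ 0ℝ
  hausdorff-refl A 0<q = excess-refl A 0<q , excess-refl A 0<q

  -- The index `nothing` contributes the value 1 to every infimum.
  hausdorff≤1 : ∀ A B → hausdorff d A B ≤ 1ℝ
  hausdorff≤1 A B 1<q = bound A B 1<q , bound B A 1<q
    where
    bound : ∀ A B → excess d A B ≤ 1ℝ
    bound A B = excess-bound A B {1ℝ} 0≤1ℝ λ _ 1<q → nothing , 1<q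

  -- The infimum need not be attained, so only closeness is extracted. The threshold ½ is below the
  -- default value 1, which forces a genuine point of `B`, and it matches the bound in
  -- `½≤distString-[]`.
  excess≤0⇒near : ∀ A B {a} → excess d A B ≤ 0ℝ → a ∈ A →
    ∃ λ b → b ∈ B × ½ ∈ cut (distString d a b)
  excess≤0⇒near A B {a} ≤0 a∈A with excess-upper d A B a∈A {½} (≤0 0<½)
  ... | nothing        , 1<½ = contradiction 1<½ (from-no (1ℚ ℚ.<? ½))
  ... | just (b , b∈B) , ½∈  = b , b∈B , ½∈

-- Unions of controllable languages and of realizations

module _ {n : ℕ} (G : Automaton n) (Euc : Subset n) where

  -- Prefix closure commutes with unions, so each prefix is extended inside the language it came
  -- from.
  Controllable-∪ : ∀ {K₁ K₂} → Controllable G Euc K₁ → Controllable G Euc K₂ →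
    Controllable G Euc (K₁ ∪ K₂)
  Controllable-∪ {K₁} {K₂} (K₁⊆L , c₁) (K₂⊆L , c₂) =
    (λ where
      (inj₁ s∈) → K₁⊆L s∈
      (inj₂ s∈) → K₂⊆L s∈) ,
    λ where
      ((s , a , (t , inj₁ st∈) , a∈ , eq) , w∈L) →
        let v , wv∈ = c₁ ((s , a , (t , st∈) , a∈ , eq) , w∈L) in v , inj₁ wv∈
      ((s , a , (t , inj₂ st∈) , a∈ , eq) , w∈L) →
        let v , wv∈ = c₂ ((s , a , (t , st∈) , a∈ , eq) , w∈L) in v , inj₂ wv∈

  module _ (d : Metric n) (λ₀ : ℝ) (λ∈[0,1] : InUnitInterval λ₀) where

    λ-Controllable-∪ : ∀ K₁ K₂ →
      λ-Controllable G Euc d λ₀ K₁ → λ-Controllable G Euc d λ₀ K₂ →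
      λ-Controllable G Euc d λ₀ (K₁ ∪ K₂)
    λ-Controllable-∪ K₁ K₂ (K₁⊆L , K̃₁ , c₁ , h₁) (K₂⊆L , K̃₂ , c₂ , h₂) =
      (λ where
        (inj₁ s∈) → K₁⊆L s∈
        (inj₂ s∈) → K₂⊆L s∈) ,
      K̃₁ ∪ K̃₂ , Controllable-∪ c₁ c₂ ,
      hausdorff-∪ d K̃₁ K̃₂ K₁ K₂ {λ₀} (proj₁ λ∈[0,1]) h₁ h₂

    IsRealization-∪ : ∀ K K̃₁ K̃₂ →
      IsRealization G Euc d λ₀ K̃₁ K → IsRealization G Euc d λ₀ K̃₂ K →
      IsRealization G Euc d λ₀ (K̃₁ ∪ K̃₂) K
    IsRealization-∪ K K̃₁ K̃₂ (c₁ , h₁) (c₂ , h₂) =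
      Controllable-∪ c₁ c₂ , hausdorff-∪ˡ d K̃₁ K̃₂ K {λ₀} (proj₁ λ∈[0,1]) h₁ h₂

-- Counterexamples over one uncontrollable letter

unary : Automaton 1
unary = record { Q = Unit.⊤ ; δ = λ _ _ → just _ ; q₀ = _ }

unary-total : Universal (L unary)
unary-total []      = Any.just _
unary-total (_ ∷ s) = unary-total s

dense⇒controllable : ∀ Euc {K} → Universal (prefixClosure K) →
  Controllable unary Euc K
dense⇒controllable Euc dense = (λ {s} _ → unary-total s) , λ {s} _ → dense s

unaryMetric : Metric 1
unaryMetric = record
  { dist      = λ _ _ → 0ℝ
  ; unit      = λ _ _ → 0∈[0,1]
  ; zero⇒≡    = λ _ → unique _ _
  ; reflexive = λ _ → id , id
  ; symmetric = λ _ _ → id , id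
  ; triangle  = λ _ _ _ (r , s , 0<r , 0<s , r+s≤q) →
                  ℚ.<-≤-trans (ℚ.+-mono-< 0<r 0<s) r+s≤q
  }
  where
  unique : (a b : Fin 1) → a ≡ b
  unique zero zero = refl

-- The empty string is a prefix of `s`, so controllability puts the one-letter string into the
-- prefix closure.
controllable-extend : ∀ {K s} → Controllable unary ⊤ K → s ∈ K →
  ∃ λ t → zero ∷ t ∈ K
controllable-extend {K} {s} (_ , c) s∈K =
  c (([] , zero , (s , s∈K) , ∈⊤ , refl) , Any.just _)

-- Oddness is encoded as evenness of the tail, so that `s ++ s` witnesses density for both
-- languages.
Even Odd∪ε : Language 1
Even s = 2 ∣ length s
Odd∪ε []      = Unit.⊤
Odd∪ε (_ ∷ s) = Even s

Even-++ : ∀ s → Even (s ++ s)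
Even-++ s = divides (length s) (trans (length-++ s) (double (length s)))
  where
  double : ∀ m → m ℕ.+ m ≡ m ℕ.* 2
  double = solve-∀

Even-dense : Universal (prefixClosure Even)
Even-dense s = s , Even-++ s

Odd∪ε-dense : Universal (prefixClosure Odd∪ε)
Odd∪ε-dense []      = [] , _
Odd∪ε-dense (_ ∷ s) = s , Even-++ s

Even∩Odd∪ε⇒[] : ∀ {s} → s ∈ Even ∩ Odd∪ε → s ≡ []
Even∩Odd∪ε⇒[] {[]}    _ = refl
Even∩Odd∪ε⇒[] {_ ∷ s} (2∣1+s , 2∣s)
  -- Two consecutive lengths would both be even, making 2 a divisor of 1.
  with () ← ∣1⇒≡1 (∣m+n∣m⇒∣n (subst (2 ∣_) (+-comm 1 (length s)) 2∣1+s) 2∣s)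

[]∈Even∩Odd∪ε : [] ∈ Even ∩ Odd∪ε
[]∈Even∩Odd∪ε = (2 ∣0) , _

Even-controllable : Controllable unary ⊤ Even
Even-controllable = dense⇒controllable ⊤ Even-dense

Odd∪ε-controllable : Controllable unary ⊤ Odd∪ε
Odd∪ε-controllable = dense⇒controllable ⊤ Odd∪ε-dense

Even∩Odd∪ε-uncontrollable : ¬ Controllable unary ⊤ (Even ∩ Odd∪ε)
Even∩Odd∪ε-uncontrollable c
  with t , ut∈ ← controllable-extend c []∈Even∩Odd∪ε
  with () ← Even∩Odd∪ε⇒[] {zero ∷ t} ut∈

controllable⇒0-controllable : ∀ K → Controllable unary ⊤ K →
  λ-Controllable unary ⊤ unaryMetric 0ℝ K
controllable⇒0-controllable K c =
  proj₁ c , K , c , λ {q} → hausdorff-refl unaryMetric K {q}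

controllable⇒1-realization : ∀ K K̃ → Controllable unary ⊤ K̃ →
  IsRealization unary ⊤ unaryMetric 1ℝ K̃ K
controllable⇒1-realization K K̃ c =
  c , λ {q} → hausdorff≤1 unaryMetric K̃ K {q}

Even∩Odd∪ε-not-0-controllable :
  ¬ λ-Controllable unary ⊤ unaryMetric 0ℝ (Even ∩ Odd∪ε)
Even∩Odd∪ε-not-0-controllable (_ , K̃ , c , h)
  -- As `[]` lies in the intersection, `K̃` must contain some string.
  with _ , s∈K̃ , _ ←
    excess≤0⇒near unaryMetric (Even ∩ Odd∪ε) K̃
      (λ {q} 0<q → proj₂ (h {q} 0<q)) []∈Even∩Odd∪ε
  with t , ut∈K̃ ← controllable-extend c s∈K̃
  with s , s∈K , ½∈ ←
    excess≤0⇒near unaryMetric K̃ (Even ∩ Odd∪ε)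
      (λ {q} 0<q → proj₁ (h {q} 0<q)) ut∈K̃
  -- The string near `zero ∷ t` can only be `[]`, which gives ½ < ½.
  with refl ← Even∩Odd∪ε⇒[] {s} s∈K =
  ℚ.<-irrefl {½} refl (½≤distString-[] unaryMetric zero t {½} ½∈)

proposition2 : (∀ (n : ℕ) (G : Automaton n) (Euc : Subset n) (d : Metric n) (λ₀ : ℝ) →
    InUnitInterval λ₀ → (K₁ K₂ : Language n) →
    λ-Controllable G Euc d λ₀ K₁ → λ-Controllable G Euc d λ₀ K₂ →
    λ-Controllable G Euc d λ₀ (K₁ ∪ K₂))
    ×
    (Σ[ n ∈ ℕ ] Σ[ G ∈ Automaton n ] Σ[ Euc ∈ Subset n ] Σ[ d ∈ Metric n ]
    Σ[ λ₀ ∈ ℝ ] Σ[ K₁ ∈ Language n ] Σ[ K₂ ∈ Language n ]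
    (InUnitInterval λ₀ ×
    λ-Controllable G Euc d λ₀ K₁ × λ-Controllable G Euc d λ₀ K₂ ×
    ¬ λ-Controllable G Euc d λ₀ (K₁ ∩ K₂)))
    ×
    (∀ (n : ℕ) (G : Automaton n) (Euc : Subset n) (d : Metric n) (λ₀ : ℝ) →
    InUnitInterval λ₀ → (K : Language n) → K ⊆ L G →
    (K̃₁ K̃₂ : Language n) →
    IsRealization G Euc d λ₀ K̃₁ K → IsRealization G Euc d λ₀ K̃₂ K →
    IsRealization G Euc d λ₀ (K̃₁ ∪ K̃₂) K)
    ×
    (Σ[ n ∈ ℕ ] Σ[ G ∈ Automaton n ] Σ[ Euc ∈ Subset n ] Σ[ d ∈ Metric n ]
    Σ[ λ₀ ∈ ℝ ] Σ[ K ∈ Language n ] Σ[ K̃₁ ∈ Language n ] Σ[ K̃₂ ∈ Language n ]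
    (InUnitInterval λ₀ × K ⊆ L G ×
    IsRealization G Euc d λ₀ K̃₁ K × IsRealization G Euc d λ₀ K̃₂ K ×
    ¬ IsRealization G Euc d λ₀ (K̃₁ ∩ K̃₂) K))
proposition2 =
  (λ n G Euc d λ₀ λ∈[0,1] → λ-Controllable-∪ G Euc d λ₀ λ∈[0,1]) ,
  (1 , unary , ⊤ , unaryMetric , 0ℝ , Even , Odd∪ε , 0∈[0,1] ,
    controllable⇒0-controllable Even Even-controllable ,
    controllable⇒0-controllable Odd∪ε Odd∪ε-controllable ,
    Even∩Odd∪ε-not-0-controllable) ,
  (λ n G Euc d λ₀ λ∈[0,1] K _ → IsRealization-∪ G Euc d λ₀ λ∈[0,1] K) ,
  (1 , unary , ⊤ , unaryMetric , 1ℝ , Even , Even , Odd∪ε , 1∈[0,1] ,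
    (λ {s} _ → unary-total s) ,
    controllable⇒1-realization Even Even Even-controllable ,
    controllable⇒1-realization Even Odd∪ε Odd∪ε-controllable ,
    λ (c , _) → Even∩Odd∪ε-uncontrollable c)
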